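{- Let $\kappa$ be a supercompact cardinal and let $H$ be a dual group of cardinality $|H| \geq \kappa$. Then for every cardinal $\chi < \kappa$ there is a direct summand $H'$ of $H$ with $\chi \leq |H'| < \kappa$.
   Context: All groups are abelian. For an abelian group $G$, $G^* = \operatorname{Hom}(G, \mathbb{Z})$ denotes its dual group. An abelian group $H$ is called a dual group if $H \cong D^*$ for some abelian group $D$. Supercompact cardinals are understood in the usual set-theoretic sense. -}

module Defs where

open import Algebra.Bundles using (AbelianGroup)
open import Algebra.Morphism.Bundles using (GroupHomomorphism)
open import Algebra.Morphism.Structures using (IsGroupIsomorphism)
import Algebra.Properties.CommutativeSemigroup as CommutativeSemigroupProperties
open import Data.Bool.Base using (Bool; T)
open import Data.Integer.Base as ℤ using (ℤ; 0ℤ)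
import Data.Integer.Properties as ℤ
open import Data.Nat.Base using (ℕ)
open import Data.Product.Base using (Σ; Σ-syntax; ∃; ∃-syntax; _×_; _,_; proj₁)
open import Data.Sum.Base using (_⊎_)
open import Function.Base using (_∘_)
open import Function.Bundles using (Injection)
open import Level using (Level; suc; _⊔_; Lift)
open import Relation.Binary.Bundles using (Setoid)
import Relation.Binary.Construct.On as On
open import Relation.Binary.PropositionalEquality
  using (_≡_; refl; sym; trans; cong; cong₂; setoid)
open import Relation.Nullary.Negation.Core using (¬_)
open import Relation.Unary using (Pred; _∈_; _⊆_; _∩_; ∁; ⋂; Empty; Universal)

private
  variable
    a b ℓ ℓ₁ ℓ₂ : Level

------------------------------------------------------------------------
-- Cardinals
--
-- A cardinal is represented by a type of that cardinality. Setoids enter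
-- because the carrier of a group is counted up to the group's equality.

infix 4 _≼_ _≺_

_≼_ : Setoid a ℓ₁ → Setoid b ℓ₂ → Set (a ⊔ b ⊔ ℓ₁ ⊔ ℓ₂)
X ≼ Y = Injection X Y

_≺_ : Setoid a ℓ₁ → Setoid b ℓ₂ → Set (a ⊔ b ⊔ ℓ₁ ⊔ ℓ₂)
X ≺ Y = X ≼ Y × ¬ (Y ≼ X)

------------------------------------------------------------------------
-- Supercompact cardinals
--
-- The universe Set ℓ plays the role of the class of all sets. Under
-- excluded middle and function extensionality, A → Bool is the power
-- set of A with _≡_ as extensional equality, and it stays in Set ℓ.

-- The set of subsets of A of cardinality < |K|. The size bound is
-- irrelevant so that a member is determined by its elements.
record 𝒫[_] (K A : Set ℓ) : Set ℓ where
  field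
    member : A → Bool
    .small : setoid (Σ A (T ∘ member)) ≺ setoid K

infix 4 _∈ₛ_

_∈ₛ_ : {K A : Set ℓ} → A → 𝒫[ K ] A → Set ℓ
_∈ₛ_ {ℓ} x P = Lift ℓ (T (𝒫[_].member P x))

record IsUltrafilter {I : Set ℓ} (U : Pred (Pred I ℓ) ℓ) : Set (suc ℓ) where
  field
    whole   : ∀ {X} → Universal X → X ∈ U
    proper  : ∀ {X} → Empty X → ¬ (X ∈ U)
    upward  : ∀ {X Y} → X ⊆ Y → X ∈ U → Y ∈ U
    meet    : ∀ {X Y} → X ∈ U → Y ∈ U → X ∩ Y ∈ U
    ultra   : ∀ X → X ∈ U ⊎ ∁ X ∈ U

IsComplete : (K : Set ℓ) {I : Set ℓ} → Pred (Pred I ℓ) ℓ → Set (suc ℓ)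
IsComplete {ℓ} K {I} U =
  {J : Set ℓ} → setoid J ≺ setoid K →
  (X : J → Pred I ℓ) → (∀ j → X j ∈ U) → ⋂ J X ∈ U

record IsNormalMeasure (K A : Set ℓ)
                       (U : Pred (Pred (𝒫[ K ] A) ℓ) ℓ) : Set (suc ℓ) where
  field
    isUltrafilter : IsUltrafilter U
    complete      : IsComplete K U
    fine          : ∀ x → (λ P → x ∈ₛ P) ∈ U
    normal        : (f : 𝒫[ K ] A → A) → (λ P → f P ∈ₛ P) ∈ U →
                    ∃[ x ] (λ P → f P ≡ x) ∈ U

-- Supercompactness via normal measures on 𝒫[ K ] A, since elementary
-- embeddings of the universe are not objects of the theory.
record Supercompact (K : Set ℓ) : Set (suc ℓ) where
  field
    uncountable   : setoid ℕ ≺ setoid K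
    normalMeasure : (A : Set ℓ) → setoid K ≼ setoid A →
                    ∃[ U ] IsNormalMeasure K A U

------------------------------------------------------------------------
-- Dual groups

infix 4 _≅_

_≅_ : AbelianGroup a ℓ₁ → AbelianGroup b ℓ₂ → Set (a ⊔ b ⊔ ℓ₁ ⊔ ℓ₂)
G ≅ H = ∃ (IsGroupIsomorphism (AbelianGroup.rawGroup G) (AbelianGroup.rawGroup H))

module _ (G : AbelianGroup a ℓ) where

  private
    module G = AbelianGroup G

    Hom : Set (a ⊔ ℓ)
    Hom = GroupHomomorphism G.rawGroup (AbelianGroup.rawGroup ℤ.+-0-abelianGroup)

    open GroupHomomorphism
    open CommutativeSemigroupProperties
      (AbelianGroup.commutativeSemigroup ℤ.+-0-abelianGroup) using (interchange)

    hom : (f : G.Carrier → ℤ) →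
          (∀ {x y} → x G.≈ y → f x ≡ f y) →
          (∀ x y → f (x G.∙ y) ≡ f x ℤ.+ f y) →
          f G.ε ≡ 0ℤ →
          (∀ x → f (x G.⁻¹) ≡ ℤ.- f x) → Hom
    hom f f-cong f-∙ f-ε f-⁻¹ = record
      { ⟦_⟧ = f
      ; isGroupHomomorphism = record
        { isMonoidHomomorphism = record
          { isMagmaHomomorphism = record
            { isRelHomomorphism = record { cong = f-cong }
            ; homo = f-∙
            }
          ; ε-homo = f-ε
          }
        ; ⁻¹-homo = f-⁻¹
        }
      }

    _+ʰ_ : Hom → Hom → Hom
    f +ʰ g = hom (λ x → ⟦ f ⟧ x ℤ.+ ⟦ g ⟧ x)
      (λ x≈y → cong₂ ℤ._+_ (⟦⟧-cong f x≈y) (⟦⟧-cong g x≈y))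
      (λ x y → trans (cong₂ ℤ._+_ (homo f x y) (homo g x y))
                     (interchange (⟦ f ⟧ x) (⟦ f ⟧ y) (⟦ g ⟧ x) (⟦ g ⟧ y)))
      (cong₂ ℤ._+_ (ε-homo f) (ε-homo g))
      (λ x → trans (cong₂ ℤ._+_ (⁻¹-homo f x) (⁻¹-homo g x))
                   (sym (ℤ.neg-distrib-+ (⟦ f ⟧ x) (⟦ g ⟧ x))))

    0ʰ : Hom
    0ʰ = hom (λ _ → 0ℤ) (λ _ → refl) (λ _ _ → refl) refl (λ _ → refl)

    -ʰ_ : Hom → Hom
    -ʰ f = hom (λ x → ℤ.- ⟦ f ⟧ x)
      (λ x≈y → cong ℤ.-_ (⟦⟧-cong f x≈y))
      (λ x y → trans (cong ℤ.-_ (homo f x y))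
                     (ℤ.neg-distrib-+ (⟦ f ⟧ x) (⟦ f ⟧ y)))
      (cong ℤ.-_ (ε-homo f))
      (λ x → cong ℤ.-_ (⁻¹-homo f x))

  dual : AbelianGroup (a ⊔ ℓ) a
  dual = record
    { Carrier = Hom
    ; _≈_     = λ f g → ∀ x → ⟦ f ⟧ x ≡ ⟦ g ⟧ x
    ; _∙_     = _+ʰ_
    ; ε       = 0ʰ
    ; _⁻¹     = -ʰ_
    ; isAbelianGroup = record
      { isGroup = record
        { isMonoid = record
          { isSemigroup = record
            { isMagma = record
              { isEquivalence = record
                { refl  = λ _ → refl
                ; sym   = λ p x → sym (p x)
                ; trans = λ p q x → trans (p x) (q x)
                }
              ; ∙-cong = λ p q x → cong₂ ℤ._+_ (p x) (q x)
              }
            ; assoc = λ f g h x → ℤ.+-assoc (⟦ f ⟧ x) (⟦ g ⟧ x) (⟦ h ⟧ x)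
            }
          ; identity = (λ f x → ℤ.+-identityˡ (⟦ f ⟧ x))
                     , (λ f x → ℤ.+-identityʳ (⟦ f ⟧ x))
          }
        ; inverse = (λ f x → ℤ.+-inverseˡ (⟦ f ⟧ x))
                  , (λ f x → ℤ.+-inverseʳ (⟦ f ⟧ x))
        ; ⁻¹-cong = λ p x → cong ℤ.-_ (p x)
        }
      ; comm = λ f g x → ℤ.+-comm (⟦ f ⟧ x) (⟦ g ⟧ x)
      }
    }

IsDualGroup : AbelianGroup ℓ ℓ → Set (suc ℓ)
IsDualGroup {ℓ} H = Σ[ D ∈ AbelianGroup ℓ ℓ ] H ≅ dual D

------------------------------------------------------------------------
-- Direct summands

module _ (G : AbelianGroup ℓ ℓ) where

  open AbelianGroup G using (Carrier; _≈_; _∙_; ε; _⁻¹)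

  record Subgroup : Set (suc ℓ) where
    field
      member    : Pred Carrier ℓ
      resp-≈    : ∀ {x y} → x ≈ y → x ∈ member → y ∈ member
      ε-closed  : ε ∈ member
      ∙-closed  : ∀ {x y} → x ∈ member → y ∈ member → x ∙ y ∈ member
      ⁻¹-closed : ∀ {x} → x ∈ member → x ⁻¹ ∈ member

module _ {G : AbelianGroup ℓ ℓ} where

  open AbelianGroup G using (Carrier; _≈_; _∙_; ε)
  open Subgroup

  ∣_∣ : Subgroup G → Setoid ℓ ℓ
  ∣ S ∣ = On.setoid {B = Σ Carrier (member S)} (AbelianGroup.setoid G) proj₁

  IsDirectSummand : Subgroup G → Set (suc ℓ)
  IsDirectSummand S = Σ[ C ∈ Subgroup G ]
    (∀ x → ∃[ s ] ∃[ c ] s ∈ member S × c ∈ member C × x ≈ s ∙ c) ×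
    (∀ x → x ∈ member S → x ∈ member C → x ≈ ε)

{-# OPTIONS --safe #-}
-- Take a normal measure on the small subsets P of D ⊎ H. For almost every P the
-- trace H ∩ P is a direct summand of H = D*, with complement the annihilator of
-- D ∩ P. Indeed, if homomorphisms h_P are chosen for all P, the limit
-- h(d) = "the value h_P(d) for almost all P" exists by countable completeness
-- and is a homomorphism; it lies in almost every P, and by normality it agrees
-- with h_P on D ∩ P for almost all P. So almost surely every functional agrees
-- on D ∩ P with a member of H ∩ P, and likewise only 0 in H ∩ P annihilates
-- D ∩ P. Fineness and completeness put χ many elements of H into almost every P.
module Submission where

open import Algebra.Bundles using (AbelianGroup)
open import Algebra.Morphism.Bundles using (GroupHomomorphism)
open import Algebra.Morphism.Structures using (IsGroupIsomorphism)
import Algebra.Properties.AbelianGroup as AbelianGroupProperties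
open import Axiom.ExcludedMiddle using (ExcludedMiddle)
open import Axiom.Extensionality.Propositional
  using (Extensionality; lower-extensionality)
open import Data.Bool.Base using (Bool; T)
open import Data.Bool.Properties using (T-irrelevant; T-≡)
open import Data.Integer.Base as ℤ using (ℤ; 0ℤ; +_; -[1+_])
import Data.Integer.Properties as ℤ
open import Data.Nat.Base using (ℕ)
open import Data.Product.Base
  using (Σ; Σ-syntax; ∃; ∃-syntax; _×_; _,_; proj₁; proj₂)
open import Data.Sum.Base using (_⊎_; inj₁; inj₂)
open import Data.Sum.Properties using (inj₁-injective; inj₂-injective)
open import Function.Base using (_∘_)
open import Function.Bundles using (Equivalence; Injection; mk⇔)
open import Function.Construct.Composition using (injection)
open import Function.Definitions using (Injective)
open import Level using (Level; Lift; lift; lower)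
open import Relation.Binary.Bundles using (Setoid)
open import Relation.Binary.PropositionalEquality
  using (_≡_; _≢_; refl; sym; trans; cong; cong₂; subst; setoid)
open import Relation.Nullary using (¬_; yes; no; contradiction)
open import Relation.Nullary.Decidable
  using (does; does-⇔; dec-true; decidable-stable; recompute)
open import Relation.Unary using (Pred; _∈_)
open import Defs

open Injection using (to) renaming (cong to to-cong; injective to to-injective)

private
  variable
    ℓ : Level

module Classical (em : ExcludedMiddle ℓ) where

  witness-of-¬∀ : {A : Set ℓ} {B : Pred A ℓ} → ¬ (∀ x → B x) → ∃[ x ] ¬ B x
  witness-of-¬∀ ¬all = decidable-stable em λ none →
    ¬all λ x → decidable-stable em λ ¬b → none (x , ¬b)

  -- Canonical representatives of the classes of a setoid.

  module Representatives (ext : Extensionality ℓ ℓ)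
                         (X : Setoid ℓ ℓ) (x₀ : Setoid.Carrier X) where
    open Setoid X using (Carrier; _≈_)
    module X = Setoid X

    choose : (Carrier → Bool) → Carrier
    choose b with em {Σ Carrier (T ∘ b)}
    ... | yes (x , _) = x
    ... | no  _       = x₀

    choose-satisfies : ∀ b → Σ Carrier (T ∘ b) → T (b (choose b))
    choose-satisfies b nonempty with em {Σ Carrier (T ∘ b)}
    ... | yes (_ , p) = p
    ... | no  empty   = contradiction nonempty empty

    -- By extensionality equivalent elements get the same Boolean function, hence
    -- the same choice from it; a Set-valued class would need propositional
    -- extensionality.
    class : Carrier → Carrier → Bool
    class x y = does (em {y ≈ x})

    rep : Carrier → Carrier
    rep = choose ∘ class

    rep-≈ : ∀ x → rep x ≈ x
    rep-≈ x = from-does (choose-satisfies (class x) (x , to-does X.refl))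
      where
      from-does : ∀ {y} → T (class x y) → y ≈ x
      from-does {y} t with em {y ≈ x}
      ... | yes y≈x = y≈x

      to-does : ∀ {y} → y ≈ x → T (class x y)
      to-does y≈x = Equivalence.from T-≡ (dec-true em y≈x)

    rep-cong : ∀ {x y} → x ≈ y → rep x ≡ rep y
    rep-cong x≈y = cong choose (lower-extensionality ℓ ℓ ext λ z →
      does-⇔ (mk⇔ (λ z≈x → X.trans z≈x x≈y) (λ z≈y → X.trans z≈y (X.sym x≈y)))
             em em)

  -- Almost-everywhere statements for an ultrafilter.

  module Ultrafilters {I : Set ℓ} (U : Pred (Pred I ℓ) ℓ)
                      (isUltrafilter : IsUltrafilter U) where
    open IsUltrafilter isUltrafilter

    ∈U⇒inhabited : ∀ {X} → X ∈ U → ∃ X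
    ∈U⇒inhabited X∈U = decidable-stable em λ none →
      proper (λ i i∈X → none (i , i∈X)) X∈U

    -- Choose a counterexample at every index that has one, and the default `x₀` elsewhere. The
    -- hypothesis for this single choice function excludes counterexamples at almost every index.
    uniformly : {A : Set ℓ} → A → (R : I → A → Set ℓ) →
                (∀ (f : I → A) → (λ i → R i (f i)) ∈ U) →
                (λ i → ∀ x → R i x) ∈ U
    uniformly {A} x₀ R almost =
      upward (λ {i} r x → decidable-stable em λ ¬r → counterexample-fails i (x , ¬r) r)
             (almost counterexample)
      where
      counterexample : I → A
      counterexample i with em {∃[ x ] ¬ R i x}
      ... | yes (x , _) = x
      ... | no  _       = x₀

      counterexample-fails : ∀ i → ∃[ x ] ¬ R i x → ¬ R i (counterexample i)
      counterexample-fails i exists with em {∃[ x ] ¬ R i x}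
      ... | yes (_ , ¬r) = ¬r
      ... | no  none     = contradiction exists none

  -- Limits and diagonal intersections for a normal measure.

  module NormalMeasures {K A : Set ℓ} (ℕ≺K : setoid ℕ ≺ setoid K)
                        {U : Pred (Pred (𝒫[ K ] A) ℓ) ℓ}
                        (isNormalMeasure : IsNormalMeasure K A U) where
    open IsNormalMeasure isNormalMeasure
    open IsUltrafilter isUltrafilter public
    open Ultrafilters U isUltrafilter public

    limit : (v : 𝒫[ K ] A → ℤ) → ∃[ c ] (λ P → Lift ℓ (v P ≡ c)) ∈ U
    limit v = decidable-stable em λ none → proper
      (λ P avoids → all-avoided (v P) (λ n → avoids (lift n)))
      -- Pairing `+ n` with `-[1+ n ]` indexes all integers by `n`, so avoiding every integer is a
      -- countable intersection of sets in `U`.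
      (complete ℕ↑≺K (λ n P → Lift ℓ (v P ≢ + lower n × v P ≢ -[1+ lower n ]))
        λ (lift n) → upward
          (λ (p , q) → lift (p ∘ lift , q ∘ lift))
          (meet (avoid none (+ n)) (avoid none -[1+ n ])))
      where
      ℕ↑≺K : setoid (Lift ℓ ℕ) ≺ setoid K
      ℕ↑≺K = injection record
               { to = lower ; cong = cong lower ; injective = cong lift }
               (proj₁ ℕ≺K)
           , λ K≼ℕ↑ → proj₂ ℕ≺K (injection K≼ℕ↑ record
               { to = lower ; cong = cong lower ; injective = cong lift })

      avoid : ¬ (∃[ c ] (λ P → Lift ℓ (v P ≡ c)) ∈ U) →
              ∀ c → (λ P → ¬ Lift ℓ (v P ≡ c)) ∈ U
      avoid none c with ultra (λ P → Lift ℓ (v P ≡ c))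
      ... | inj₁ is-c = contradiction (c , is-c) none
      ... | inj₂ not-c = not-c

      all-avoided : ∀ z → ¬ (∀ n → Lift ℓ (z ≢ + n × z ≢ -[1+ n ]))
      all-avoided (+ n)    avoids = proj₁ (lower (avoids n)) refl
      all-avoided -[1+ n ] avoids = proj₂ (lower (avoids n)) refl

    -- Closure under diagonal intersections. By `uniformly` one choice function `f` is tested at a
    -- time; if `g (f P)` lies in `P` almost always, normality makes `g ∘ f`, hence `f`, almost
    -- constant, and a single `X b` decides.
    diagonal : {B : Set ℓ} → B → (g : B → A) → Injective _≡_ _≡_ g →
               (X : B → Pred (𝒫[ K ] A) ℓ) → (∀ b → X b ∈ U) →
               (λ P → ∀ b → g b ∈ₛ P → P ∈ X b) ∈ U
    diagonal b₀ g g-injective X X∈U =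
      uniformly b₀ (λ P b → g b ∈ₛ P → P ∈ X b) along
      where
      along : ∀ f → (λ P → g (f P) ∈ₛ P → P ∈ X (f P)) ∈ U
      along f with ultra (λ P → g (f P) ∈ₛ P)
      ... | inj₂ outside = upward (λ ∉P ∈P → contradiction ∈P ∉P) outside
      ... | inj₁ inside  =
        let x , gf≡x = normal (g ∘ f) inside
            -- The constant value `x` lives in `A`; any such `Q` supplies the index `f Q` in `B`
            -- behind it.
            Q , gfQ≡x = ∈U⇒inhabited gf≡x
        in upward
             (λ {P} (gfP≡x , P∈X) _ →
               subst (λ b → P ∈ X b) (g-injective (trans gfQ≡x (sym gfP≡x))) P∈X)
             (meet gf≡x (X∈U (f Q)))

    -- The bound is stored irrelevantly; excluded middle decides it, so it can be recomputed.
    ∈ₛ-small : (P : 𝒫[ K ] A) →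
               setoid (Σ A (T ∘ 𝒫[_].member P)) ≺ setoid K
    ∈ₛ-small record { small = small } = recompute em small

  -- Traces of small sets on a dual group.

  module DualSummand
    (ext : Extensionality ℓ ℓ) {K : Set ℓ} (ℕ≺K : setoid ℕ ≺ setoid K)
    (H D : AbelianGroup ℓ ℓ) (H≅D* : H ≅ dual D)
    {U : Pred (Pred (𝒫[ K ] (AbelianGroup.Carrier D ⊎ AbelianGroup.Carrier H)) ℓ) ℓ}
    (isNormalMeasure : IsNormalMeasure K _ U)
    where

    open AbelianGroup H using (Carrier; _≈_; _∙_; ε; _⁻¹)
    module H = AbelianGroup H
    module D = AbelianGroup D
    open IsNormalMeasure isNormalMeasure using (complete; fine)
    open NormalMeasures ℕ≺K isNormalMeasure
    open Representatives ext H.setoid ε using (rep; rep-≈; rep-cong)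
    open IsGroupIsomorphism (proj₂ H≅D*)
      using (surjective; injective; ∙-homo; ε-homo; ⁻¹-homo; ⟦⟧-cong)

    Small : Set ℓ
    Small = 𝒫[ K ] (D.Carrier ⊎ Carrier)

    infix 8 _⟨_⟩
    _⟨_⟩ : Carrier → D.Carrier → ℤ
    h ⟨ d ⟩ = GroupHomomorphism.⟦_⟧ (proj₁ H≅D* h) d

    module ⟨⟩ h = GroupHomomorphism (proj₁ H≅D* h)

    -- `P` need not respect `_≈_`; testing the representative makes the trace a union of classes.
    trace : Small → Pred Carrier ℓ
    trace P h = inj₂ (rep h) ∈ₛ P

    annihilates : Small → Pred Carrier ℓ
    annihilates P h = ∀ d → inj₁ d ∈ₛ P → h ⟨ d ⟩ ≡ 0ℤ

    trace-resp-≈ : ∀ P {x y} → x ≈ y → x ∈ trace P → y ∈ trace P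
    trace-resp-≈ P x≈y = subst (λ r → inj₂ r ∈ₛ P) (rep-cong x≈y)

    functional : (f : D.Carrier → ℤ) →
                 (∀ {x y} → x D.≈ y → f x ≡ f y) →
                 (∀ x y → f (x D.∙ y) ≡ f x ℤ.+ f y) →
                 f D.ε ≡ 0ℤ →
                 (∀ x → f (x D.⁻¹) ≡ ℤ.- f x) →
                 ∃[ h ] (∀ d → h ⟨ d ⟩ ≡ f d)
    functional f f-cong f-∙ f-ε f-⁻¹ =
      let h , ≈f = surjective record
            { ⟦_⟧ = f
            ; isGroupHomomorphism = record
              { isMonoidHomomorphism = record
                { isMagmaHomomorphism = record
                  { isRelHomomorphism = record { cong = f-cong }
                  ; homo = f-∙
                  }
                ; ε-homo = f-ε
                }
              ; ⁻¹-homo = f-⁻¹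
              }
            }
      in h , ≈f H.refl

    -- Each homomorphism law involves at most three values, so some one `P` attains all their limits
    -- and the law is inherited from `h P`.
    limit-functional : (h : Small → Carrier) →
      ∃[ h* ] (∀ d → (λ P → Lift ℓ (h P ⟨ d ⟩ ≡ h* ⟨ d ⟩)) ∈ U)
    limit-functional h =
      let h* , h*≡f = functional f f-cong f-∙ f-ε f-⁻¹
      in h* , λ d → upward (λ (lift p) → lift (trans p (sym (h*≡f d)))) (f-limit d)
      where
      f : D.Carrier → ℤ
      f d = proj₁ (limit (λ P → h P ⟨ d ⟩))

      f-limit : ∀ d → (λ P → Lift ℓ (h P ⟨ d ⟩ ≡ f d)) ∈ U
      f-limit d = proj₂ (limit (λ P → h P ⟨ d ⟩))

      f-cong : ∀ {x y} → x D.≈ y → f x ≡ f y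
      f-cong {x} {y} x≈y =
        let P , lift p , lift q = ∈U⇒inhabited (meet (f-limit x) (f-limit y))
        in trans (sym p) (trans (⟨⟩.⟦⟧-cong (h P) x≈y) q)

      f-∙ : ∀ x y → f (x D.∙ y) ≡ f x ℤ.+ f y
      f-∙ x y =
        let P , lift p , lift q , lift r = ∈U⇒inhabited
              (meet (f-limit (x D.∙ y)) (meet (f-limit x) (f-limit y)))
        in trans (sym p) (trans (⟨⟩.homo (h P) x y) (cong₂ ℤ._+_ q r))

      f-ε : f D.ε ≡ 0ℤ
      f-ε =
        let P , lift p = ∈U⇒inhabited (f-limit D.ε)
        in trans (sym p) (⟨⟩.ε-homo (h P))

      f-⁻¹ : ∀ x → f (x D.⁻¹) ≡ ℤ.- f x
      f-⁻¹ x =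
        let P , lift p , lift q = ∈U⇒inhabited
              (meet (f-limit (x D.⁻¹)) (f-limit x))
        in trans (sym p) (trans (⟨⟩.⁻¹-homo (h P) x) (cong ℤ.-_ q))

    Agree : Small → Carrier → Carrier → Set ℓ
    Agree P h h′ = ∀ d → inj₁ d ∈ₛ P → h ⟨ d ⟩ ≡ h′ ⟨ d ⟩

    traces-represent : (λ P → ∀ h → ∃[ h′ ] h′ ∈ trace P × Agree P h h′) ∈ U
    traces-represent = uniformly ε _ λ h →
      let h* , h→h* = limit-functional h
      in upward
           (λ (agree , h*∈P) → h* , h*∈P , λ d d∈P → lower (agree d d∈P))
           -- The limit is fixed before `P`, so fineness applies to it; the diagonal intersection
           -- turns agreement at each `d` into agreement on all of `D ∩ P`.
           (meet (diagonal D.ε inj₁ inj₁-injective _ h→h*) (fine (inj₂ (rep h*))))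

    -- A nonzero `h` has a nonzero value at some `d`, and almost every `P` contains that `d`.
    separated : ∀ h → (λ P → h ∈ annihilates P → h ≈ ε) ∈ U
    separated h with em {h ≈ ε}
    ... | yes h≈ε = whole λ _ _ → h≈ε
    ... | no  h≉ε =
      let d , hd≢0 = nonzero-value
      in upward (λ d∈P ann → contradiction (lift (ann d d∈P)) hd≢0) (fine (inj₁ d))
      where
      nonzero-value : ∃[ d ] ¬ Lift ℓ (h ⟨ d ⟩ ≡ 0ℤ)
      nonzero-value = witness-of-¬∀ λ zero → h≉ε
        (injective λ d → trans (lower (zero d)) (sym (ε-homo d)))

    traces-separated :
      (λ P → ∀ h → inj₂ h ∈ₛ P → h ∈ annihilates P → h ≈ ε) ∈ U
    traces-separated = diagonal ε inj₂ inj₂-injective _ separated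

    traces-∙ : (λ P → ∀ x → inj₂ x ∈ₛ P → ∀ y → inj₂ y ∈ₛ P → x ∙ y ∈ trace P) ∈ U
    traces-∙ = diagonal ε inj₂ inj₂-injective _ λ x →
               diagonal ε inj₂ inj₂-injective _ λ y → fine (inj₂ (rep (x ∙ y)))

    traces-⁻¹ : (λ P → ∀ x → inj₂ x ∈ₛ P → x ⁻¹ ∈ trace P) ∈ U
    traces-⁻¹ = diagonal ε inj₂ inj₂-injective _ λ x → fine (inj₂ (rep (x ⁻¹)))

    annihilator : Small → Subgroup H
    annihilator P = record
      { member    = annihilates P
      ; resp-≈    = λ x≈y ann d d∈P → trans (sym (⟦⟧-cong x≈y d)) (ann d d∈P)
      ; ε-closed  = λ d _ → ε-homo d
      ; ∙-closed  = λ {x} {y} annx anny d d∈P →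
          trans (∙-homo x y d) (cong₂ ℤ._+_ (annx d d∈P) (anny d d∈P))
      ; ⁻¹-closed = λ {x} ann d d∈P →
          trans (⁻¹-homo x d) (cong ℤ.-_ (ann d d∈P))
      }

    Agree⇒annihilates : ∀ P {h h′} → Agree P h h′ → h ∙ h′ ⁻¹ ∈ annihilates P
    Agree⇒annihilates P {h} {h′} agree d d∈P =
      trans (∙-homo h (h′ ⁻¹) d)
      (trans (cong₂ ℤ._+_ (agree d d∈P) (⁻¹-homo h′ d))
             (ℤ.+-inverseʳ (h′ ⟨ d ⟩)))

    record Good (P : Small) : Set ℓ where
      field
        represent : ∀ h → ∃[ h′ ] h′ ∈ trace P × Agree P h h′
        separate  : ∀ h → inj₂ h ∈ₛ P → h ∈ annihilates P → h ≈ ε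
        ε-trace   : ε ∈ trace P
        ∙-trace   : ∀ x → inj₂ x ∈ₛ P → ∀ y → inj₂ y ∈ₛ P → x ∙ y ∈ trace P
        ⁻¹-trace  : ∀ x → inj₂ x ∈ₛ P → x ⁻¹ ∈ trace P

      traceSubgroup : Subgroup H
      traceSubgroup = record
        { member    = trace P
        ; resp-≈    = trace-resp-≈ P
        ; ε-closed  = ε-trace
        ; ∙-closed  = λ {x} {y} x∈ y∈ →
            -- Closure is known for literal members of `P`, so the product of representatives is
            -- carried back along `rep-≈`.
            trace-resp-≈ P (H.∙-cong (rep-≈ x) (rep-≈ y)) (∙-trace (rep x) x∈ (rep y) y∈)
        ; ⁻¹-closed = λ {x} x∈ →
            trace-resp-≈ P (H.⁻¹-cong (rep-≈ x)) (⁻¹-trace (rep x) x∈)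
        }

      isDirectSummand : IsDirectSummand traceSubgroup
      isDirectSummand = annihilator P , decompose , meet-trivially
        where
        decompose : ∀ x → ∃[ s ] ∃[ c ] s ∈ trace P × c ∈ annihilates P × x ≈ s ∙ c
        decompose x =
          let s , s∈ , agree = represent x
          -- Since `s` agrees with `x` on `D ∩ P`, the difference annihilates `D ∩ P`.
          in s , x ∙ s ⁻¹ , s∈ , Agree⇒annihilates P agree
           , H.sym (H.trans (H.sym (H.assoc s x (s ⁻¹)))
                            (AbelianGroupProperties.xyx⁻¹≈y H s x))

        meet-trivially : ∀ x → x ∈ trace P → x ∈ annihilates P → x ≈ ε
        meet-trivially x x∈ ann = H.trans (H.sym (rep-≈ x))
          (separate (rep x) x∈
            (Subgroup.resp-≈ (annihilator P) (H.sym (rep-≈ x)) ann))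

    almost-all-good : Good ∈ U
    almost-all-good = upward
      (λ (represent , separate , ε-trace , ∙-trace , ⁻¹-trace) → record
        { represent = represent ; separate = separate ; ε-trace = ε-trace
        ; ∙-trace = ∙-trace ; ⁻¹-trace = ⁻¹-trace })
      (meet traces-represent (meet traces-separated
        (meet (fine (inj₂ (rep ε))) (meet traces-∙ traces-⁻¹))))

    -- `rep` turns `_≈_` into equality and so embeds the trace into `P`.
    traceSubgroup-small : ∀ {P} (good : Good P) →
                          ∣ Good.traceSubgroup good ∣ ≺ setoid K
    traceSubgroup-small {P} good =
        injection trace≼P (proj₁ (∈ₛ-small P))
      , λ K≼trace → proj₂ (∈ₛ-small P) (injection K≼trace trace≼P)
      where
      trace≼P : ∣ Good.traceSubgroup good ∣ ≼ setoid (Σ _ (T ∘ 𝒫[_].member P))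
      trace≼P = record
        { to = λ (h , h∈) → inj₂ (rep h) , lower h∈
        ; cong = λ x≈y → Σ-≡ (cong inj₂ (rep-cong x≈y))
        ; injective = λ {(x , _)} {(y , _)} eq →
            H.trans (H.sym (rep-≈ x))
              (H.trans (H.reflexive (inj₂-injective (cong proj₁ eq))) (rep-≈ y))
        }
        where
        Σ-≡ : ∀ {x y} {p : T (𝒫[_].member P x)} {q : T (𝒫[_].member P y)} →
              x ≡ y → (x , p) ≡ (y , q)
        Σ-≡ {x} refl = cong (x ,_) (T-irrelevant _ _)

    traces-large : {C : Set ℓ} → setoid C ≺ setoid K → (e : C → Carrier) →
                   (λ P → ∀ c → e c ∈ trace P) ∈ U
    traces-large C≺K e = complete C≺K _ λ c → fine (inj₂ (rep (e c)))

theorem1p1 : ∀ {ℓ} → ExcludedMiddle ℓ → Extensionality ℓ ℓ →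
    (κ : Set ℓ) → Supercompact κ →
    (H : AbelianGroup ℓ ℓ) → IsDualGroup H →
    setoid κ ≼ AbelianGroup.setoid H →
    (χ : Set ℓ) → setoid χ ≺ setoid κ →
    Σ[ H′ ∈ Subgroup H ]
    IsDirectSummand H′ × setoid χ ≼ ∣ H′ ∣ × ∣ H′ ∣ ≺ setoid κ
theorem1p1 em ext κ κ-supercompact H (D , H≅D*) κ≼H χ χ≺κ =
  -- Two sets in `U` meet, so a single `P` yields both the summand and its lower bound.
  let P , good , χ∈P = ∈U⇒inhabited (meet almost-all-good (traces-large χ≺κ (to χ≼H)))
  in Good.traceSubgroup good
   , Good.isDirectSummand good
   , record { to = λ c → to χ≼H c , χ∈P c
            ; cong = to-cong χ≼H
            ; injective = to-injective χ≼H }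
   , traceSubgroup-small good
  where
  open Supercompact κ-supercompact
  open Classical em

  χ≼H : setoid χ ≼ AbelianGroup.setoid H
  χ≼H = injection (proj₁ χ≺κ) κ≼H

  κ≼D⊎H : setoid κ ≼ setoid (AbelianGroup.Carrier D ⊎ AbelianGroup.Carrier H)
  κ≼D⊎H = record
    -- The summand `H` alone makes `D ⊎ H` large enough to carry a normal measure.
    { to = inj₂ ∘ to κ≼H
    ; cong = cong (inj₂ ∘ to κ≼H)
    ; injective = λ eq →
        to-injective κ≼H (AbelianGroup.reflexive H (inj₂-injective eq))
    }

  open DualSummand ext uncountable H D H≅D* (proj₂ (normalMeasure _ κ≼D⊎H))
  open NormalMeasures uncountable (proj₂ (normalMeasure _ κ≼D⊎H))
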